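{- Let $G$ be a forest with $n = |V(G)|$ vertices. Then for every positive integer $r \geq n - 5$, the $r$-independence complex $\mathrm{Ind}_r(G)$ is shellable.
   Context: For a graph $G$ and integer $r \geq 1$, a subset $A \subseteq V(G)$ is $r$-independent if every connected component of the induced subgraph $G[A]$ has at most $r$ vertices. The $r$-independence complex $\mathrm{Ind}_r(G)$ is the simplicial complex on $V(G)$ whose faces are the $r$-independent subsets of $V(G)$. A (not necessarily pure) simplicial complex $\Delta$ is shellable if its facets can be ordered $F_1, \dots, F_t$ so that for each $k > 1$ the complex $\langle F_k \rangle \cap \langle F_1, \dots, F_{k-1}\rangle$ is pure of dimension $\dim F_k - 1$, where $\langle \mathcal{F}\rangle$ denotes the simplicial complex generated by the sets in $\mathcal{F}$. -}

module Defs where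

open import Data.Nat using (ℕ; _≤_; _∸_)
open import Data.Bool using (Bool; true; false; T)
open import Data.Fin using (Fin)
open import Data.Fin.Subset using (Subset; _∈_; _⊆_; ∣_∣)
open import Data.List using (List; []; _∷_; _++_; [_]; length)
open import Data.List.Relation.Unary.All using (All)
open import Data.List.Relation.Unary.Any using (Any)
open import Data.List.Relation.Unary.Unique.Propositional using (Unique)
import Data.List.Membership.Propositional as LM
open import Data.Unit using (⊤)
open import Data.Product using (_×_)
open import Relation.Nullary using (¬_)
open import Relation.Binary.PropositionalEquality using (_≡_; _≢_)

record SimpleGraph (n : ℕ) : Set where
  field
    adj    : Fin n → Fin n → Bool
    sym    : ∀ u v → adj u v ≡ adj v u
    irrefl : ∀ u → adj u u ≡ false

open SimpleGraph public

Adj : ∀ {n} → SimpleGraph n → Fin n → Fin n → Set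
Adj G u v = T (adj G u v)

AdjChain : ∀ {n} → SimpleGraph n → List (Fin n) → Set
AdjChain G []           = ⊤
AdjChain G (x ∷ [])     = ⊤
AdjChain G (x ∷ y ∷ xs) = Adj G x y × AdjChain G (y ∷ xs)

IsCycle : ∀ {n} → SimpleGraph n → Fin n → List (Fin n) → Set
IsCycle G v vs = Unique (v ∷ vs) × (2 ≤ length vs) × AdjChain G (v ∷ vs ++ [ v ])

IsForest : ∀ {n} → SimpleGraph n → Set
IsForest G = ∀ v vs → ¬ IsCycle G v vs

data Reach {n} (G : SimpleGraph n) (A : Subset n) (u : Fin n) : Fin n → Set where
  here : u ∈ A → Reach G A u u
  step : ∀ {v w} → Reach G A u v → Adj G v w → w ∈ A → Reach G A u w

-- every connected component of G[A] has at most r vertices: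
-- any list of distinct vertices in the component of v has length ≤ r
RIndependent : ∀ {n} → ℕ → SimpleGraph n → Subset n → Set
RIndependent {n} r G A =
  ∀ (v : Fin n) → v ∈ A → (xs : List (Fin n)) → Unique xs → All (Reach G A v) xs → length xs ≤ r

Complex : ℕ → Set₁
Complex n = Subset n → Set

Ind : ∀ {n} → ℕ → SimpleGraph n → Complex n
Ind r G A = RIndependent r G A

IsFacet : ∀ {n} → Complex n → Subset n → Set
IsFacet Δ σ = Δ σ × (∀ τ → Δ τ → σ ⊆ τ → σ ≡ τ)

PureOfCard : ∀ {n} → Complex n → ℕ → Set
PureOfCard Δ m = ∀ σ → IsFacet Δ σ → ∣ σ ∣ ≡ m

Meet : ∀ {n} → Subset n → List (Subset n) → Complex n
Meet F pre σ = σ ⊆ F × Any (σ ⊆_) pre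

-- a shelling order: a repetition-free list of exactly the facets of Δ such that
-- for each F_k with k > 1, ⟨F_k⟩ ∩ ⟨F_1,…,F_{k-1}⟩ is pure of dimension dim F_k - 1
-- (i.e. all its facets have cardinality ∣F_k∣ - 1)
IsShelling : ∀ {n} → Complex n → List (Subset n) → Set
IsShelling Δ Fs =
  Unique Fs ×
  (∀ σ → IsFacet Δ σ → σ LM.∈ Fs) ×
  (∀ σ → σ LM.∈ Fs → IsFacet Δ σ) ×
  (∀ pre F suf → Fs ≡ pre ++ F ∷ suf → pre ≢ [] → PureOfCard (Meet F pre) (∣ F ∣ ∸ 1))

data Shellable {n} (Δ : Complex n) : Set where
  shelling : (Fs : List (Subset n)) → IsShelling Δ Fs → Shellable Δ

{-# OPTIONS --safe #-}
module Submission where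

-- The complex is vertex decomposable. Consider the r-independent sets A with B ⊆ A ⊆ U, where B
-- is r-independent and U is not. Root the forest and let v be a deepest vertex whose branch
-- (the vertices of U below v, connected to v within U) has more than r vertices; among the
-- vertices of that branch outside B let x have the largest branch. Then x is a shedding vertex:
-- a set A that is maximal among those avoiding x contains everything below x, and if A ∪ {x} were
-- r-independent, some y below v adjacent to the component C of v in A ∪ {x} would be missing
-- from A; trading the branch of x for the smaller branch of y turns C into a set of at most r
-- vertices that contains the component of y in A ∪ {y}, against maximality. A shelling lists
-- the facets without x first, then those with x, recursively.

open import Defs
open import Data.Nat using (ℕ; zero; suc; _≤_; _∸_; _+_; _<_; z≤n; s≤s; _≤?_; _<?_)
open import Data.Nat.Properties as ℕₚ using
  (≤-refl; ≤-reflexive; ≤-trans; ≤-pred; <-irrefl; <-asym; <⇒≤; <⇒≱; ≤-<-trans; <-≤-trans;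
   ≤-total; ≰⇒>; +-suc; +-comm; +-monoˡ-≤; m≤n⇒m≤1+n; <-cmp)
open import Data.Fin using (Fin; zero; suc; _≟_)
open import Data.Fin.Properties using (suc-injective; any?; all?; ¬∀⟶∃¬)
open import Data.Fin.Subset using
  (Subset; inside; outside; ⊥; ⊤; ⁅_⁆; _∈_; _∉_; _⊆_; _⊂_; _⊃_; _∪_; _─_; _-_; ∣_∣)
open import Data.Fin.Subset.Properties using
  (_∈?_; drop-∷-⊆; nonempty?; ∉⊥; ⊥⊆; ∈⊤; ⊆⊤; x∈⁅x⁆; x∈⁅y⁆⇒x≡y; ∣⁅x⁆∣≡1; ⊆-refl; ⊆-trans;
   ⊆-antisym; p⊆q⇒∣p∣≤∣q∣; p⊂q⇒∣p∣<∣q∣; p⊆p∪q; q⊆p∪q; x∈p∪q⁻; p─q⊆p; x∈p∧x∉q⇒x∈p─q;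
   x∈p∧x≢y⇒x∈p-y; x∈p⇒∣p-x∣<∣p∣; x∈p⇒p-x⊂p)
open import Data.Fin.Subset.Induction using (⊂-wellFounded; ⊃-wellFounded)
open import Data.Vec using ([]; _∷_; here; there; tabulate)
open import Data.Vec.Properties using (lookup∘tabulate; []=⇒lookup; lookup⇒[]=)
open import Data.List using (List; []; _∷_; _++_; [_]; length; map; take)
open import Data.List.Properties using (length-map; length-++; ∷-injective)
open import Data.List.Relation.Unary.All as All using (All; []; _∷_)
import Data.List.Relation.Unary.All.Properties as Allₚ
open import Data.List.Relation.Unary.AllPairs using ([]; _∷_)
open import Data.List.Relation.Unary.Any using (here; there)
open import Data.List.Relation.Unary.Unique.Propositional using (Unique)
import Data.List.Relation.Unary.Unique.Propositional.Properties as Uniqueₚ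
import Data.List.Membership.Propositional as LM
open import Data.List.Membership.Propositional.Properties using (∈-++⁺ˡ; ∈-++⁺ʳ; ∈-++⁻; ∈-∃++)
import Data.List.Membership.DecPropositional as DecMembership
open import Data.Bool using (T; T?)
open import Data.Product using (∃; _×_; _,_; proj₁; proj₂)
open import Data.Sum using (_⊎_; inj₁; inj₂; [_,_]′)
open import Data.Unit using (tt)
open import Function using (_∘_; case_of_)
open import Induction.WellFounded using (Acc; acc)
open import Relation.Nullary using
  (¬_; Dec; yes; no; does; contradiction; map′; _×-dec_; _→-dec_; ¬?)
open import Relation.Nullary.Decidable using (dec-true; decidable-stable)
open import Relation.Binary.Definitions using (tri<; tri≈; tri>)
open import Relation.Binary.PropositionalEquality as ≡ using (_≡_; _≢_; refl; cong; subst)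

-- Finite subsets

x∈p─q⇒x∉q : ∀ {n} {x : Fin n} (p q : Subset n) → x ∈ p ─ q → x ∉ q
x∈p─q⇒x∉q (_ ∷ p) (inside ∷ q) ()        here
x∈p─q⇒x∉q (_ ∷ p) (_ ∷ q)      (there h) (there k) = x∈p─q⇒x∉q p q h k

x∉p-x : ∀ {n} {x : Fin n} (p : Subset n) → x ∉ p - x
x∉p-x p h = x∈p─q⇒x∉q p ⁅ _ ⁆ h (x∈⁅x⁆ _)

x∈p-y⇒x≢y : ∀ {n} {x y : Fin n} (p : Subset n) → x ∈ p - y → x ≢ y
x∈p-y⇒x≢y p h refl = x∉p-x p h

x∈p∪⁅x⁆ : ∀ {n} {x : Fin n} (p : Subset n) → x ∈ p ∪ ⁅ x ⁆
x∈p∪⁅x⁆ p = q⊆p∪q p ⁅ _ ⁆ (x∈⁅x⁆ _)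

x∈p∪⁅y⁆⁻ : ∀ {n} {x y : Fin n} (p : Subset n) → x ∈ p ∪ ⁅ y ⁆ → x ∈ p ⊎ x ≡ y
x∈p∪⁅y⁆⁻ {y = y} p h with x∈p∪q⁻ p ⁅ y ⁆ h
... | inj₁ k = inj₁ k
... | inj₂ k = inj₂ (x∈⁅y⁆⇒x≡y y k)

∪-⁅⁆-⊆ : ∀ {n} {x : Fin n} (p : Subset n) {q} → p ⊆ q → x ∈ q → p ∪ ⁅ x ⁆ ⊆ q
∪-⁅⁆-⊆ p p⊆q x∈q h with x∈p∪⁅y⁆⁻ p h
... | inj₁ k    = p⊆q k
... | inj₂ refl = x∈q

∣p∪q∣≤∣p∣+∣q∣ : ∀ {n} (p q : Subset n) → ∣ p ∪ q ∣ ≤ ∣ p ∣ + ∣ q ∣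
∣p∪q∣≤∣p∣+∣q∣ []            []            = z≤n
∣p∪q∣≤∣p∣+∣q∣ (outside ∷ p) (outside ∷ q) = ∣p∪q∣≤∣p∣+∣q∣ p q
∣p∪q∣≤∣p∣+∣q∣ (outside ∷ p) (inside ∷ q)  rewrite +-suc ∣ p ∣ ∣ q ∣ = s≤s (∣p∪q∣≤∣p∣+∣q∣ p q)
∣p∪q∣≤∣p∣+∣q∣ (inside ∷ p)  (outside ∷ q) = s≤s (∣p∪q∣≤∣p∣+∣q∣ p q)
∣p∪q∣≤∣p∣+∣q∣ (inside ∷ p)  (inside ∷ q)  rewrite +-suc ∣ p ∣ ∣ q ∣ =
  s≤s (m≤n⇒m≤1+n (∣p∪q∣≤∣p∣+∣q∣ p q))

∣p─q∣+∣q∣≡∣p∣ : ∀ {n} (p q : Subset n) → q ⊆ p → ∣ p ─ q ∣ + ∣ q ∣ ≡ ∣ p ∣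
∣p─q∣+∣q∣≡∣p∣ []            []            _   = refl
∣p─q∣+∣q∣≡∣p∣ (inside ∷ p)  (inside ∷ q)  q⊆p =
  ≡.trans (+-suc ∣ p ─ q ∣ ∣ q ∣) (cong suc (∣p─q∣+∣q∣≡∣p∣ p q (drop-∷-⊆ q⊆p)))
∣p─q∣+∣q∣≡∣p∣ (inside ∷ p)  (outside ∷ q) q⊆p = cong suc (∣p─q∣+∣q∣≡∣p∣ p q (drop-∷-⊆ q⊆p))
∣p─q∣+∣q∣≡∣p∣ (outside ∷ p) (outside ∷ q) q⊆p = ∣p─q∣+∣q∣≡∣p∣ p q (drop-∷-⊆ q⊆p)
∣p─q∣+∣q∣≡∣p∣ (outside ∷ p) (inside ∷ q)  q⊆p with () ← q⊆p here

∣p-x∣≡∣p∣∸1 : ∀ {n} {x : Fin n} (p : Subset n) → x ∈ p → ∣ p - x ∣ ≡ ∣ p ∣ ∸ 1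
∣p-x∣≡∣p∣∸1 {x = x} p x∈p = ≡.trans (≡.sym (ℕₚ.m+n∸n≡m ∣ p - x ∣ 1)) (cong (_∸ 1) sum)
  where
  ⁅x⁆⊆p : ⁅ x ⁆ ⊆ p
  ⁅x⁆⊆p h with refl ← x∈⁅y⁆⇒x≡y x h = x∈p
  sum : ∣ p - x ∣ + 1 ≡ ∣ p ∣
  sum = subst (λ k → ∣ p - x ∣ + k ≡ ∣ p ∣) (∣⁅x⁆∣≡1 x) (∣p─q∣+∣q∣≡∣p∣ p ⁅ x ⁆ ⁅x⁆⊆p)

module _ {n} {P : Fin n → Set} (P? : ∀ x → Dec (P x)) where

  comprehension : Subset n
  comprehension = tabulate (does ∘ P?)

  ∈-comprehension⁺ : ∀ {x} → P x → x ∈ comprehension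
  ∈-comprehension⁺ {x} px =
    lookup⇒[]= x _ (≡.trans (lookup∘tabulate _ x) (dec-true (P? x) px))

  ∈-comprehension⁻ : ∀ {x} → x ∈ comprehension → P x
  ∈-comprehension⁻ {x} h with P? x | ≡.trans (≡.sym (lookup∘tabulate (does ∘ P?) x)) ([]=⇒lookup h)
  ... | yes px | _  = px
  ... | no _   | ()

-- Together with `enumerate` this translates the bound on duplicate-free lists in `RIndependent`
-- into a bound on cardinalities.
length≤∣p∣ : ∀ {n} {xs : List (Fin n)} {p} → Unique xs → All (_∈ p) xs → length xs ≤ ∣ p ∣
length≤∣p∣ []       []         = z≤n
length≤∣p∣ (x∉ ∷ u) (x∈ ∷ all) =
  ≤-trans (s≤s (length≤∣p∣ u (All.zipWith (λ (y∈p , x≢y) → x∈p∧x≢y⇒x∈p-y y∈p (x≢y ∘ ≡.sym)) (all , x∉))))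
          (x∈p⇒∣p-x∣<∣p∣ x∈)

enumerate : ∀ {n} (p : Subset n) → ∃ λ xs → Unique xs × All (_∈ p) xs × length xs ≡ ∣ p ∣
enumerate []      = [] , [] , [] , refl
enumerate (s ∷ p) with enumerate p
enumerate (outside ∷ p) | xs , u , all , eq =
  map suc xs , Uniqueₚ.map⁺ suc-injective u , Allₚ.map⁺ (All.map there all) ,
  ≡.trans (length-map suc xs) eq
enumerate (inside ∷ p) | xs , u , all , eq =
  zero ∷ map suc xs ,
  Allₚ.map⁺ (All.universal (λ _ ()) xs) ∷ Uniqueₚ.map⁺ suc-injective u ,
  here ∷ Allₚ.map⁺ (All.map there all) ,
  cong suc (≡.trans (length-map suc xs) eq)

argmax : ∀ {n} {P : Fin n → Set} → (∀ x → Dec (P x)) → (f : Fin n → ℕ) → ∃ P →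
         ∃ λ x → P x × ∀ y → P y → f y ≤ f x
argmax {zero}  P? f (() , _)
argmax {suc n} P? f e with any? (P? ∘ suc)
argmax {suc n} P? f (zero , p)  | no ¬q =
  zero , p , λ { zero _ → ≤-refl ; (suc y) q → contradiction (y , q) ¬q }
argmax {suc n} P? f (suc x , p) | no ¬q = contradiction (x , p) ¬q
... | yes q with argmax (P? ∘ suc) (f ∘ suc) q | P? zero
...   | x , px , max | no ¬p0 =
  suc x , px , λ { zero p0 → contradiction p0 ¬p0 ; (suc y) → max y }
...   | x , px , max | yes p0 with ≤-total (f zero) (f (suc x))
...     | inj₁ le = suc x , px , λ { zero _ → le ; (suc y) → max y }
...     | inj₂ ge = zero , p0 , λ { zero _ → ≤-refl ; (suc y) q′ → ≤-trans (max y q′) ge }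

-- Shellability of hereditary families with shedding vertices

-- Maximality is tested by adding single vertices, which suffices in a family closed under subsets.
Maximal : ∀ {n} → Complex n → Subset n → Subset n → Set
Maximal Δ U A = A ⊆ U × Δ A × (∀ y → y ∈ U → y ∉ A → ¬ Δ (A ∪ ⁅ y ⁆))

-- The exchange form of a shelling order: the intersection of `F` with any earlier facet lies in
-- some `F - x` that is itself contained in an earlier facet.
LinearOrder : ∀ {n} → List (Subset n) → Set
LinearOrder Fs = ∀ pre F suf → Fs ≡ pre ++ F ∷ suf → ∀ {F′} → F′ LM.∈ pre →
  ∃ λ x → x ∈ F × x ∉ F′ × ∃ λ F″ → F″ LM.∈ pre × F - x ⊆ F″

++-split : ∀ {A : Set} (xs : List A) {ys} pre {z} suf → xs ++ ys ≡ pre ++ z ∷ suf →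
  (∃ λ suf′ → xs ≡ pre ++ z ∷ suf′) ⊎ (∃ λ pre′ → pre ≡ xs ++ pre′ × ys ≡ pre′ ++ z ∷ suf)
++-split []       pre       suf eq   = inj₂ (pre , refl , eq)
++-split (x ∷ xs) []        suf refl = inj₁ (xs , refl)
++-split (x ∷ xs) (p ∷ pre) suf eq with ∷-injective eq
... | refl , eq′ with ++-split xs pre suf eq′
...   | inj₁ (suf′ , refl)        = inj₁ (suf′ , refl)
...   | inj₂ (pre′ , refl , refl) = inj₂ (pre′ , refl , refl)

-- A facet `σ` of the intersection lies in `F` and in some earlier `F′`. The exchange vertex `x` is
-- missing from `F′`, so `σ ⊆ F - x`; as `F - x` also belongs to the intersection, the two are
-- equal.
linearOrder⇒pure : ∀ {n} {Fs : List (Subset n)} → LinearOrder Fs → ∀ pre F suf → Fs ≡ pre ++ F ∷ suf →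
                   PureOfCard (Meet F pre) (∣ F ∣ ∸ 1)
linearOrder⇒pure lin pre F suf eq σ ((σ⊆F , any) , max)
  with LM.find any
... | F′ , F′∈ , σ⊆F′ with lin pre F suf eq F′∈
...   | x , x∈F , x∉F′ , F″ , F″∈ , F-x⊆F″
  rewrite max (F - x) (p─q⊆p F ⁅ x ⁆ , LM.lose F″∈ F-x⊆F″)
              (λ y∈σ → x∈p∧x≢y⇒x∈p-y (σ⊆F y∈σ) λ { refl → x∉F′ (σ⊆F′ y∈σ) })
  = ∣p-x∣≡∣p∣∸1 F x∈F

-- The usual shedding condition, that facets of the deletion of `x` remain facets, relative to the
-- interval from `B` to `U`.
Shedding : ∀ {n} → Complex n → Subset n → Subset n → Fin n → Set
Shedding Δ B U x =
  x ∈ U × x ∉ B × (∀ {A} → B ⊆ A → Maximal Δ (U - x) A → ¬ Δ (A ∪ ⁅ x ⁆))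

module _ {n} (Δ : Complex n) (Δ? : ∀ A → Dec (Δ A)) (down : ∀ {A B} → A ⊆ B → Δ B → Δ A) where

  extend-to-maximal : ∀ {U A} → A ⊆ U → Δ A → ∃ λ M → A ⊆ M × Maximal Δ U M
  extend-to-maximal {U} {A} = go A (⊃-wellFounded A)
    where
    go : ∀ A → Acc _⊃_ A → A ⊆ U → Δ A → ∃ λ M → A ⊆ M × Maximal Δ U M
    go A (acc rec) A⊆U ΔA
      with any? (λ y → y ∈? U ×-dec ¬? (y ∈? A) ×-dec Δ? (A ∪ ⁅ y ⁆))
    ... | no ¬y = A , ⊆-refl , A⊆U , ΔA , λ y y∈U y∉A Δy → ¬y (y , y∈U , y∉A , Δy)
    ... | yes (y , y∈U , y∉A , Δy)
      with go (A ∪ ⁅ y ⁆) (rec (p⊆p∪q ⁅ y ⁆ , y , x∈p∪⁅x⁆ A , y∉A)) (∪-⁅⁆-⊆ A A⊆U y∈U) Δy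
    ...   | M , A∪y⊆M , max = M , ⊆-trans (p⊆p∪q ⁅ y ⁆) A∪y⊆M , max

  facet⇒maximal : ∀ {A} → IsFacet Δ A → Maximal Δ ⊤ A
  facet⇒maximal {A} (ΔA , max) = ⊆⊤ , ΔA , λ y _ y∉A Δy →
    y∉A (subst (y ∈_) (≡.sym (max _ Δy (p⊆p∪q ⁅ y ⁆))) (x∈p∪⁅x⁆ A))

  maximal⇒facet : ∀ {A} → Maximal Δ ⊤ A → IsFacet Δ A
  maximal⇒facet {A} (_ , ΔA , max) = ΔA , λ τ Δτ A⊆τ → ⊆-antisym A⊆τ λ {y} y∈τ →
    decidable-stable (y ∈? A) λ y∉A → max y ∈⊤ y∉A (down (∪-⁅⁆-⊆ A A⊆τ y∈τ) Δτ)

  module _ (shedding : ∀ {B U} → B ⊆ U → Δ B → ¬ Δ U → ∃ (Shedding Δ B U)) where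

    -- The interval from `B` to `U` stands for the link of `B` in the restriction to `U`. Facets are
    -- recorded with `B` included, so deletions and links need no change of vertex set.
    record Order (B U : Subset n) : Set where
      field
        facets   : List (Subset n)
        unique   : Unique facets
        complete : ∀ {F} → B ⊆ F → Maximal Δ U F → F LM.∈ facets
        sound    : ∀ {F} → F LM.∈ facets → B ⊆ F × Maximal Δ U F
        linear   : LinearOrder facets

    open Order

    -- Deleting `x` removes it from `U`, passing to the link adds it to `B`; either way `U ─ B`
    -- shrinks.
    order : ∀ {B U} → B ⊆ U → Δ B → Order B U
    order {B} {U} = go (⊂-wellFounded (U ─ B))
      where
      go : ∀ {B U} → Acc _⊂_ (U ─ B) → B ⊆ U → Δ B → Order B U
      go {B} {U} (acc rec) B⊆U ΔB with Δ? U
      ... | yes ΔU = record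
        { facets   = [ U ]
        ; unique   = [] ∷ []
        ; complete = λ { {F} B⊆F (F⊆U , ΔF , max) → here (⊆-antisym F⊆U λ {y} y∈U →
            decidable-stable (y ∈? F) λ y∉F → max y y∈U y∉F (down (∪-⁅⁆-⊆ F F⊆U y∈U) ΔU)) }
        ; sound    = λ { (here refl) → B⊆U , ⊆-refl , ΔU , λ y y∈U y∉U → contradiction y∈U y∉U }
        ; linear   = λ { [] F suf eq () ; (p ∷ []) F suf () ; (p ∷ q ∷ pre) F suf () }
        }
      ... | no ¬ΔU with shedding B⊆U ΔB ¬ΔU
      ...   | x , x∈U , x∉B , shed = record
        { facets   = facets without ++ with-x
        ; unique   = Uniqueₚ.++⁺ (unique without) with-x-unique λ (h , k) →
            x∉without h (proj₁ (with-x-sound k) (x∈p∪⁅x⁆ B))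
        ; complete = all-complete
        ; sound    = λ h → [ without-sound , (λ k → ⊆-trans (p⊆p∪q ⁅ x ⁆) (proj₁ (with-x-sound k)) ,
                                                proj₂ (with-x-sound k)) ]′ (∈-++⁻ (facets without) h)
        ; linear   = all-linear
        }
        where
        without : Order B (U - x)
        without = go (rec ((λ h → x∈p∧x∉q⇒x∈p─q (p─q⊆p U ⁅ x ⁆ (p─q⊆p (U - x) B h)) (x∈p─q⇒x∉q (U - x) B h))
                          , x , x∈p∧x∉q⇒x∈p─q x∈U x∉B , λ h → x∉p-x U (p─q⊆p (U - x) B h)))
                     (λ h → x∈p∧x≢y⇒x∈p-y (B⊆U h) λ { refl → x∉B h }) ΔB

        x∉without : ∀ {F} → F LM.∈ facets without → x ∉ F
        x∉without F∈ x∈F = x∉p-x U (proj₁ (proj₂ (sound without F∈)) x∈F)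

        without-sound : ∀ {F} → F LM.∈ facets without → B ⊆ F × Maximal Δ U F
        without-sound F∈ with sound without F∈
        ... | B⊆F , max@(F⊆ , ΔF , ext) = B⊆F , p─q⊆p U ⁅ x ⁆ ∘ F⊆ , ΔF , λ y y∈U y∉F → case y ≟ x of λ where
          -- Maximality in `U - x` says nothing about adding `x` itself; that is the case the
          -- shedding property settles.
          (yes refl) → shed B⊆F max
          (no y≢x)   → ext y (x∈p∧x≢y⇒x∈p-y y∈U y≢x) y∉F

        -- If `B ∪ ⁅ x ⁆` is not a face, no face contains it and the second block is empty. The
        -- decision is an argument so that the lemmas about `with-x` can match on it.
        link : Dec (Δ (B ∪ ⁅ x ⁆)) → List (Subset n)
        link-order : Δ (B ∪ ⁅ x ⁆) → Order (B ∪ ⁅ x ⁆) U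
        link-order Δx = go (rec ((λ h → x∈p∧x∉q⇒x∈p─q (p─q⊆p U _ h) λ k → x∈p─q⇒x∉q U _ h (p⊆p∪q ⁅ x ⁆ k))
                                , x , x∈p∧x∉q⇒x∈p─q x∈U x∉B , λ h → x∈p─q⇒x∉q U _ h (x∈p∪⁅x⁆ B)))
                           (∪-⁅⁆-⊆ B B⊆U x∈U) Δx
        link (yes Δx) = facets (link-order Δx)
        link (no _)   = []

        with-x : List (Subset n)
        with-x = link (Δ? (B ∪ ⁅ x ⁆))

        with-x-unique : Unique with-x
        with-x-unique with Δ? (B ∪ ⁅ x ⁆)
        ... | yes Δx = unique (link-order Δx)
        ... | no _   = []

        with-x-sound : ∀ {F} → F LM.∈ with-x → B ∪ ⁅ x ⁆ ⊆ F × Maximal Δ U F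
        with-x-sound h with Δ? (B ∪ ⁅ x ⁆)
        ... | yes Δx = sound (link-order Δx) h
        with-x-sound () | no _

        with-x-complete : ∀ {F} → B ∪ ⁅ x ⁆ ⊆ F → Maximal Δ U F → F LM.∈ with-x
        with-x-complete Bx⊆F max with Δ? (B ∪ ⁅ x ⁆)
        ... | yes Δx = complete (link-order Δx) Bx⊆F max
        ... | no ¬Δx = contradiction (down Bx⊆F (proj₁ (proj₂ max))) ¬Δx

        with-x-linear : LinearOrder with-x
        with-x-linear with Δ? (B ∪ ⁅ x ⁆)
        ... | yes Δx = linear (link-order Δx)
        ... | no _   = λ { [] F suf () ; (p ∷ pre) F suf () }

        all-complete : ∀ {F} → B ⊆ F → Maximal Δ U F → F LM.∈ facets without ++ with-x
        all-complete {F} B⊆F max@(F⊆U , ΔF , ext) with x ∈? F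
        ... | yes x∈F = ∈-++⁺ʳ (facets without) (with-x-complete (∪-⁅⁆-⊆ B B⊆F x∈F) max)
        ... | no x∉F  = ∈-++⁺ˡ (complete without B⊆F
          ( (λ h → x∈p∧x≢y⇒x∈p-y (F⊆U h) λ { refl → x∉F h }) , ΔF
          , λ y y∈ → ext y (p─q⊆p U ⁅ x ⁆ y∈)))

        all-linear : LinearOrder (facets without ++ with-x)
        all-linear pre F suf eq F′∈ with ++-split (facets without) pre suf eq
        ... | inj₁ (suf′ , eq′) = linear without pre F suf′ eq′ F′∈
        ... | inj₂ (pre′ , refl , eq′) with ∈-++⁻ (facets without) F′∈
        ...   | inj₂ F′∈pre′ with with-x-linear pre′ F suf eq′ F′∈pre′
        ...     | y , y∈F , y∉F′ , F″ , F″∈ , sub =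
          y , y∈F , y∉F′ , F″ , ∈-++⁺ʳ (facets without) F″∈ , sub
        -- Here `F` contains `x` and `F′` does not, so `x` is the exchange vertex: `F - x` extends
        -- to a maximal set avoiding `x`, and this lies in the first block, hence before `F`.
        all-linear pre F suf eq F′∈ | inj₂ (pre′ , refl , eq′) | inj₁ F′∈without
          with with-x-sound (subst (F LM.∈_) (≡.sym eq′) (∈-++⁺ʳ pre′ (here refl)))
        ... | Bx⊆F , F⊆U , ΔF , _
          with extend-to-maximal {U = U - x} {A = F - x}
                 (λ h → x∈p∧x≢y⇒x∈p-y (F⊆U (p─q⊆p F ⁅ x ⁆ h)) (x∈p-y⇒x≢y F h))
                 (down (p─q⊆p F ⁅ x ⁆) ΔF)
        ...   | F″ , F-x⊆F″ , max =
          x , Bx⊆F (x∈p∪⁅x⁆ B) , x∉without F′∈without , F″ ,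
          ∈-++⁺ˡ (complete without
            (λ h → F-x⊆F″ (x∈p∧x≢y⇒x∈p-y (Bx⊆F (p⊆p∪q ⁅ x ⁆ h)) λ { refl → x∉B h })) max) ,
          F-x⊆F″

    shellable : Δ ⊥ → Shellable Δ
    shellable Δ⊥ = shelling (facets o)
      ( unique o
      , (λ σ f → complete o ⊥⊆ (facet⇒maximal f))
      , (λ σ h → maximal⇒facet (proj₂ (sound o h)))
      , (λ pre F suf eq _ → linearOrder⇒pure (linear o) pre F suf eq) )
      where
      o : Order ⊥ ⊤
      o = order ⊥⊆ Δ⊥

-- Rootings of forests

-- The parent of a vertex is its only neighbour of smaller depth, and vertices without one are
-- roots. Depth need not be the distance to a root. The bound `depth<∣U∣` leaves room to add a
-- further vertex deeper than all others.
record RootingOn {n} (G : SimpleGraph n) (U : Subset n) : Set where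
  field
    depth         : Fin n → ℕ
    depth<∣U∣     : ∀ {u} → u ∈ U → depth u < ∣ U ∣
    depth-≢       : ∀ {u v} → u ∈ U → v ∈ U → Adj G u v → depth u ≢ depth v
    parent-unique : ∀ {u v w} → u ∈ U → v ∈ U → w ∈ U → Adj G u v → Adj G u w →
                    depth v < depth u → depth w < depth u → v ≡ w

module _ {n} (G : SimpleGraph n) where

  adj-sym : ∀ {u v} → Adj G u v → Adj G v u
  adj-sym {u} {v} = subst T (SimpleGraph.sym G u v)

  adj-irrefl : ∀ {u} → ¬ Adj G u u
  adj-irrefl {u} = subst T (irrefl G u)

  unique-prefix : ∀ {A : Set} (xs : List A) {y ys} → Unique (xs ++ y ∷ ys) → Unique (xs ++ [ y ])
  unique-prefix []       _        = [] ∷ []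
  unique-prefix (x ∷ xs) {y} (x∉ ∷ u) =
    Allₚ.++⁺ (Allₚ.++⁻ˡ xs x∉) (All.head (Allₚ.++⁻ʳ xs x∉) ∷ []) ∷ unique-prefix xs u

  chain-prefix : ∀ xs {y ys z} → AdjChain G (xs ++ y ∷ ys) → Adj G y z →
                 AdjChain G ((xs ++ [ y ]) ++ [ z ])
  chain-prefix []           _       a = a , tt
  chain-prefix (x ∷ [])     (b , c) a = b , a , tt
  chain-prefix (x ∷ p ∷ xs) (b , c) a = b , chain-prefix (p ∷ xs) c a

  -- The part of the path from `x` to `y` is closed up by the edge between them. As `z` lies
  -- strictly between, the cycle has at least three vertices.
  chord⇒cycle : ∀ {x y z ys} → y LM.∈ ys → Unique (x ∷ z ∷ ys) → AdjChain G (x ∷ z ∷ ys) →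
                Adj G x y → ∃ λ vs → IsCycle G x vs
  chord⇒cycle {x} {y} {z} y∈ys u chain xy with ∈-∃++ y∈ys
  ... | as , bs , refl =
    z ∷ as ++ [ y ] ,
    unique-prefix (x ∷ z ∷ as) u ,
    s≤s (≤-trans (ℕₚ.m≤n+m 1 (length as)) (≤-reflexive (≡.sym (length-++ as)))) ,
    chain-prefix (x ∷ z ∷ as) chain (adj-sym xy)

  -- Degree at most one within `U`, so isolated vertices count.
  Leaf : Subset n → Fin n → Set
  Leaf U x = ∀ {v w} → v ∈ U → w ∈ U → Adj G x v → Adj G x w → v ≡ w

  module _ (forest : IsForest G) where

    -- A path in `U` is prolonged at its head for as long as the head has a neighbour other than its
    -- predecessor. Such a neighbour cannot lie on the path, since the chord would give a cycle.
    ∃-leaf : ∀ {U x} → x ∈ U → ∃ λ y → y ∈ U × Leaf U y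
    ∃-leaf {U} x∈U = walk ∣ U ∣ _ [] ([] ∷ []) (x∈U ∷ []) tt (≤-reflexive (ℕₚ.+-comm 1 ∣ U ∣))
      where
      _∈L?_ = DecMembership._∈?_ (_≟_ {n})

      -- `take 1 xs` holds the predecessor of the head, or nothing at the start of the walk.
      ∈-take1-unique : ∀ {v w} (xs : List (Fin n)) → v LM.∈ take 1 xs → w LM.∈ take 1 xs → v ≡ w
      ∈-take1-unique (x ∷ xs) (here refl) (here refl) = refl

      -- The fuel `k` plus the length of the path stays above `∣ U ∣`, so when `k` is zero the path
      -- has more distinct vertices than `U`.
      walk : ∀ k x xs → Unique (x ∷ xs) → All (_∈ U) (x ∷ xs) → AdjChain G (x ∷ xs) →
             ∣ U ∣ < k + length (x ∷ xs) → ∃ λ y → y ∈ U × Leaf U y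
      walk zero    x xs u all chain lt = contradiction (length≤∣p∣ u all) (<⇒≱ lt)
      walk (suc k) x xs u all chain lt
        with any? (λ y → y ∈? U ×-dec T? (adj G x y) ×-dec ¬? (y ∈L? take 1 xs))
      ... | no ¬y = x , All.head all , λ {v} {w} v∈U w∈U xv xw → ∈-take1-unique xs
        (decidable-stable (v ∈L? take 1 xs) λ v∉ → ¬y (v , v∈U , xv , v∉))
        (decidable-stable (w ∈L? take 1 xs) λ w∉ → ¬y (w , w∈U , xw , w∉))
      ... | yes (y , y∈U , xy , y∉) with y ∈L? xs
      ...   | no y∉xs = walk k y (x ∷ xs)
        (((λ { refl → adj-irrefl xy }) ∷ Allₚ.¬Any⇒All¬ xs y∉xs) ∷ u) (y∈U ∷ all)
        (adj-sym xy , chain) (≤-trans lt (≤-reflexive (≡.sym (+-suc k (length (x ∷ xs))))))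
      walk (suc k) x (z ∷ zs) u all chain lt | yes (y , y∈U , xy , y∉) | yes (here refl) =
        contradiction (here refl) y∉
      walk (suc k) x (z ∷ zs) u all chain lt | yes (y , y∈U , xy , y∉) | yes (there y∈zs) =
        contradiction (proj₂ (chord⇒cycle y∈zs u chain xy)) (forest _ _)

    -- Root `U - l` for a leaf `l`, then give `l` the depth `∣ U - l ∣`, larger than every other
    -- depth in `U`. So `l` is nobody's parent, and it has at most one neighbour to serve as its
    -- own.
    forest⇒rooting : ∀ U → RootingOn G U
    forest⇒rooting U = go U (⊂-wellFounded U)
      where
      go : ∀ U → Acc _⊂_ U → RootingOn G U
      go U (acc rec) with nonempty? U
      ... | no ¬u = record
        { depth = λ _ → 0
        ; depth<∣U∣     = λ u∈U → contradiction (_ , u∈U) ¬u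
        ; depth-≢       = λ u∈U → contradiction (_ , u∈U) ¬u
        ; parent-unique = λ u∈U → contradiction (_ , u∈U) ¬u
        }
      ... | yes (x , x∈U) with ∃-leaf x∈U
      ...   | l , l∈U , leaf = record
        { depth         = depth
        ; depth<∣U∣     = depth<∣U∣
        ; depth-≢       = depth-≢
        ; parent-unique = parent-unique
        }
        where
        module R = RootingOn (go (U - l) (rec (x∈p⇒p-x⊂p l∈U)))

        depth : Fin n → ℕ
        depth u with u ≟ l
        ... | yes _ = ∣ U - l ∣
        ... | no _  = R.depth u

        ∈-rest : ∀ {u} → u ∈ U → u ≢ l → u ∈ U - l
        ∈-rest = x∈p∧x≢y⇒x∈p-y

        depth<∣U∣ : ∀ {u} → u ∈ U → depth u < ∣ U ∣
        depth<∣U∣ {u} u∈U with u ≟ l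
        ... | yes _  = x∈p⇒∣p-x∣<∣p∣ l∈U
        ... | no u≢l = ≤-trans (R.depth<∣U∣ (∈-rest u∈U u≢l)) (<⇒≤ (x∈p⇒∣p-x∣<∣p∣ l∈U))

        depth-≢ : ∀ {u v} → u ∈ U → v ∈ U → Adj G u v → depth u ≢ depth v
        depth-≢ {u} {v} u∈U v∈U uv eq with u ≟ l | v ≟ l
        ... | yes refl | yes refl = adj-irrefl uv
        ... | yes _    | no v≢l   = <-irrefl (≡.sym eq) (R.depth<∣U∣ (∈-rest v∈U v≢l))
        ... | no u≢l   | yes _    = <-irrefl eq (R.depth<∣U∣ (∈-rest u∈U u≢l))
        ... | no u≢l   | no v≢l   = R.depth-≢ (∈-rest u∈U u≢l) (∈-rest v∈U v≢l) uv eq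

        parent-unique : ∀ {u v w} → u ∈ U → v ∈ U → w ∈ U → Adj G u v → Adj G u w →
                        depth v < depth u → depth w < depth u → v ≡ w
        parent-unique {u} {v} {w} u∈U v∈U w∈U uv uw v<u w<u with u ≟ l | v ≟ l | w ≟ l
        ... | yes refl | _        | _        = leaf v∈U w∈U uv uw
        ... | no u≢l   | yes _    | _        = contradiction (R.depth<∣U∣ (∈-rest u∈U u≢l)) (<-asym v<u)
        ... | no u≢l   | no _     | yes _    = contradiction (R.depth<∣U∣ (∈-rest u∈U u≢l)) (<-asym w<u)
        ... | no u≢l   | no v≢l   | no w≢l   =
          R.parent-unique (∈-rest u∈U u≢l) (∈-rest v∈U v≢l) (∈-rest w∈U w≢l) uv uw v<u w<u

-- Reachability

module _ {n} {G : SimpleGraph n} where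

  reach-∈ : ∀ {A u v} → Reach G A u v → v ∈ A
  reach-∈ (here u∈A)     = u∈A
  reach-∈ (step _ _ w∈A) = w∈A

  reach-trans : ∀ {A u v w} → Reach G A u v → Reach G A v w → Reach G A u w
  reach-trans p (here _)         = p
  reach-trans p (step q adj w∈A) = step (reach-trans p q) adj w∈A

  reach-sym : ∀ {A u v} → Reach G A u v → Reach G A v u
  reach-sym (here u∈A)       = here u∈A
  reach-sym (step p adj w∈A) =
    reach-trans (step (here w∈A) (adj-sym G adj) (reach-∈ p)) (reach-sym p)

  reach-mono : ∀ {A B u v} → A ⊆ B → Reach G A u v → Reach G B u v
  reach-mono A⊆B (here u∈A)       = here (A⊆B u∈A)
  reach-mono A⊆B (step p adj w∈A) = step (reach-mono A⊆B p) adj (A⊆B w∈A)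

  ind-mono : ∀ {r A B} → A ⊆ B → Ind r G B → Ind r G A
  ind-mono A⊆B ind v v∈A xs u all = ind v (A⊆B v∈A) xs u (All.map (reach-mono A⊆B) all)

  ind-⊥ : ∀ {r} → Ind r G ⊥
  ind-⊥ v v∈⊥ = contradiction v∈⊥ ∉⊥

-- Ancestor paths in a rooted forest

module Rooted {n} (G : SimpleGraph n) (rooting : RootingOn G ⊤) (r : ℕ) where

  open RootingOn rooting using (depth)

  Parent : Fin n → Fin n → Set
  Parent u w = Adj G u w × depth w < depth u

  parent? : ∀ u w → Dec (Parent u w)
  parent? u w = T? (adj G u w) ×-dec depth w <? depth u

  parent-unique : ∀ {u v w} → Parent u v → Parent u w → v ≡ w
  parent-unique (uv , v<u) (uw , w<u) = RootingOn.parent-unique rooting ∈⊤ ∈⊤ ∈⊤ uv uw v<u w<u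

  adj⇒parent : ∀ {u v} → Adj G u v → Parent u v ⊎ Parent v u
  adj⇒parent {u} {v} uv with <-cmp (depth u) (depth v)
  ... | tri< u<v _ _ = inj₂ (adj-sym G uv , u<v)
  ... | tri≈ _ u≡v _ = contradiction u≡v (RootingOn.depth-≢ rooting ∈⊤ ∈⊤ uv)
  ... | tri> _ _ v<u = inj₁ (uv , v<u)

  data Climb (A : Subset n) (u : Fin n) : Fin n → Set where
    here : u ∈ A → Climb A u u
    up   : ∀ {w v} → u ∈ A → Parent u w → Climb A w v → Climb A u v

  climb-start : ∀ {A u v} → Climb A u v → u ∈ A
  climb-start (here u∈A)   = u∈A
  climb-start (up u∈A _ _) = u∈A

  climb-end : ∀ {A u v} → Climb A u v → v ∈ A
  climb-end (here u∈A) = u∈A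
  climb-end (up _ _ c) = climb-end c

  climb-trans : ∀ {A u v w} → Climb A u v → Climb A v w → Climb A u w
  climb-trans (here _)     d = d
  climb-trans (up u∈A p c) d = up u∈A p (climb-trans c d)

  climb-mono : ∀ {A B u v} → A ⊆ B → Climb A u v → Climb B u v
  climb-mono A⊆B (here u∈A)   = here (A⊆B u∈A)
  climb-mono A⊆B (up u∈A p c) = up (A⊆B u∈A) p (climb-mono A⊆B c)

  climb-depth : ∀ {A u v} → Climb A u v → depth v ≤ depth u
  climb-depth (here _)           = ≤-refl
  climb-depth (up _ (_ , w<u) c) = ≤-trans (climb-depth c) (<⇒≤ w<u)

  climb-depth-< : ∀ {A u v} → Climb A u v → u ≢ v → depth v < depth u
  climb-depth-< (here _)           u≢v = contradiction refl u≢v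
  climb-depth-< (up _ (_ , w<u) c) _   = ≤-<-trans (climb-depth c) w<u

  -- As parents are unique, both climbs follow the same route. What remains of the longer one after
  -- the shorter ends keeps its own vertex set.
  climb-linear : ∀ {A B u v w} → Climb A u v → Climb B u w → Climb B v w ⊎ Climb A w v
  climb-linear (here _)     d            = inj₁ d
  climb-linear c@(up _ _ _) (here _)     = inj₂ c
  climb-linear (up _ p c)   (up _ q d) with refl ← parent-unique p q = climb-linear c d

  climb-restrict : ∀ {U A u v} → Climb U u v → (∀ {z} → Climb U u z → Climb U z v → z ∈ A) →
                   Climb A u v
  climb-restrict c@(here u∈U)   h = here (h c c)
  climb-restrict c@(up u∈U p d) h =
    up (h (here u∈U) c) p (climb-restrict d λ a b → h (up u∈U p a) b)

  climb? : ∀ A u v → Dec (Climb A u v)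
  climb? A u v = go (suc (depth u)) u ≤-refl
    where
    -- The fuel bounds the depth, which drops at each parent.
    go : ∀ k u → depth u < k → Dec (Climb A u v)
    go (suc k) u u<k with u ∈? A
    ... | no u∉A = no (u∉A ∘ climb-start)
    ... | yes u∈A with u ≟ v
    ...   | yes refl = yes (here u∈A)
    ...   | no u≢v = map′ (λ (w , p , c) → up u∈A p c)
                          (λ { (here _) → contradiction refl u≢v ; (up {w} _ p c) → w , p , c })
                          (any? via)
      where
      via : ∀ w → Dec (Parent u w × Climb A w v)
      via w with parent? u w
      ... | no ¬p = no (¬p ∘ proj₁)
      ... | yes p = map′ (p ,_) proj₂ (go k w (<-≤-trans (proj₂ p) (≤-pred u<k)))

  climb-top : ∀ {U u} → u ∈ U → ∃ λ t → Climb U u t × (∀ {w} → Parent t w → w ∉ U)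
  climb-top {U} {u} = go (suc (depth u)) u ≤-refl
    where
    go : ∀ k u → depth u < k → u ∈ U → ∃ λ t → Climb U u t × (∀ {w} → Parent t w → w ∉ U)
    go (suc k) u u<k u∈U with any? (λ w → parent? u w ×-dec w ∈? U)
    ... | no ¬w = u , here u∈U , λ p w∈U → ¬w (_ , p , w∈U)
    ... | yes (w , p , w∈U) with go k w (<-≤-trans (proj₂ p) (≤-pred u<k)) w∈U
    ...   | t , c , top = t , up u∈U p c , top

  climb⇒reach : ∀ {A u v} → Climb A u v → Reach G A u v
  climb⇒reach (here u∈A)   = here u∈A
  climb⇒reach (up u∈A p c) =
    reach-trans (step (here u∈A) (proj₁ p) (climb-start c)) (climb⇒reach c)

  -- Connected vertices have a common ancestor within `A`. A step down prolongs the second climb. A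
  -- step up either prolongs the first climb, if `v` was the meeting point, or retraces the second,
  -- which must pass through the unique parent.
  reach⇒climb : ∀ {A u v} → Reach G A u v → ∃ λ w → Climb A u w × Climb A v w
  reach⇒climb (here u∈A) = _ , here u∈A , here u∈A
  reach⇒climb (step p adj w∈A) with reach⇒climb p | adj⇒parent adj
  ... | t , c , d          | inj₂ q = t , c , up w∈A q d
  ... | _ , c , here v∈A   | inj₁ q = _ , climb-trans c (up v∈A q (here w∈A)) , here w∈A
  ... | t , c , up v∈A p d | inj₁ q with refl ← parent-unique p q = t , c , d

  meet⇒reach : ∀ {A u v w} → Climb A u w → Climb A v w → Reach G A u v
  meet⇒reach c d = reach-trans (climb⇒reach c) (reach-sym (climb⇒reach d))

  reach? : ∀ A u v → Dec (Reach G A u v)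
  reach? A u v = map′ (λ (_ , c , d) → meet⇒reach c d) reach⇒climb
                      (any? λ w → climb? A u w ×-dec climb? A v w)

  -- Components and branches

  component : Subset n → Fin n → Subset n
  component A v = comprehension (reach? A v)

  branch : Subset n → Fin n → Subset n
  branch U v = comprehension (λ u → climb? U u v)

  ∈-branch⁺ : ∀ {U u v} → Climb U u v → u ∈ branch U v
  ∈-branch⁺ {U} {v = v} = ∈-comprehension⁺ (λ u → climb? U u v)

  ∈-branch⁻ : ∀ {U u v} → u ∈ branch U v → Climb U u v
  ∈-branch⁻ {U} {v = v} = ∈-comprehension⁻ (λ u → climb? U u v)

  ∈-component⁺ : ∀ {A u v} → Reach G A v u → u ∈ component A v
  ∈-component⁺ {A} {v = v} = ∈-comprehension⁺ (reach? A v)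

  ∈-component⁻ : ∀ {A u v} → u ∈ component A v → Reach G A v u
  ∈-component⁻ {A} {v = v} = ∈-comprehension⁻ (reach? A v)

  component-≤ : ∀ {A v} → Ind r G A → v ∈ A → ∣ component A v ∣ ≤ r
  component-≤ {A} {v} ind v∈A with enumerate (component A v)
  ... | xs , u , all , eq = subst (_≤ r) eq (ind v v∈A xs u (All.map ∈-component⁻ all))

  components-≤⇒ind : ∀ {A} → (∀ v → v ∈ A → ∣ component A v ∣ ≤ r) → Ind r G A
  components-≤⇒ind h v v∈A xs u all = ≤-trans (length≤∣p∣ u (All.map ∈-component⁺ all)) (h v v∈A)

  small? : ∀ A v → Dec (v ∈ A → ∣ component A v ∣ ≤ r)
  small? A v = (v ∈? A) →-dec (∣ component A v ∣ ≤? r)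

  ind? : ∀ A → Dec (Ind r G A)
  ind? A = map′ components-≤⇒ind (λ ind v → component-≤ ind) (all? (small? A))

  big-component : ∀ {A} → ¬ Ind r G A → ∃ λ v → v ∈ A × r < ∣ component A v ∣
  big-component {A} ¬ind with ¬∀⟶∃¬ n _ (small? A) (¬ind ∘ components-≤⇒ind)
  ... | v , ¬small = v , decidable-stable (v ∈? A) (λ v∉A → ¬small λ v∈A → contradiction v∈A v∉A) ,
                     ≰⇒> (λ le → ¬small λ _ → le)

  -- A component of `A ∪ ⁅ z ⁆` without `z` is already connected in `A`, hence has at most `r`
  -- vertices; so the oversized one contains `z`.
  big-component-at : ∀ {A z} → Ind r G A → ¬ Ind r G (A ∪ ⁅ z ⁆) → r < ∣ component (A ∪ ⁅ z ⁆) z ∣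
  big-component-at {A} {z} ind ¬ind with big-component ¬ind
  ... | v , v∈ , big with reach? (A ∪ ⁅ z ⁆) z v
  ...   | yes zv = <-≤-trans big (p⊆q⇒∣p∣≤∣q∣ λ h → ∈-component⁺ (reach-trans zv (∈-component⁻ h)))
  ...   | no ¬zv = contradiction
    (≤-trans (p⊆q⇒∣p∣≤∣q∣ λ h → ∈-component⁺ (avoid (∈-component⁻ h))) (component-≤ ind v∈A)) (<⇒≱ big)
    where
    v∈A : v ∈ A
    v∈A with x∈p∪⁅y⁆⁻ A v∈
    ... | inj₁ k    = k
    ... | inj₂ refl = contradiction (here v∈) ¬zv
    avoid : ∀ {u} → Reach G (A ∪ ⁅ z ⁆) v u → Reach G A v u
    avoid (here _) = here v∈A
    avoid (step p adj w∈) with x∈p∪⁅y⁆⁻ A w∈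
    ... | inj₁ w∈A  = step (avoid p) adj w∈A
    ... | inj₂ refl = contradiction (reach-sym (step p adj w∈)) ¬zv

  branch-< : ∀ {U y z} → Climb U y z → y ≢ z → ∣ branch U y ∣ < ∣ branch U z ∣
  branch-< c y≢z = p⊂q⇒∣p∣<∣q∣
    ( (λ h → ∈-branch⁺ (climb-trans (∈-branch⁻ h) c))
    , _ , ∈-branch⁺ (here (climb-end c))
    , λ h → <⇒≱ (climb-depth-< c y≢z) (climb-depth (∈-branch⁻ h)))

  -- Climb from an oversized component to its top `t`. No parent of `t` is in `U`, so the component
  -- lies in the branch of `t`.
  big-branch : ∀ {U} → ¬ Ind r G U → ∃ λ v → v ∈ U × r < ∣ branch U v ∣
  big-branch {U} ¬ind with big-component ¬ind
  ... | v , v∈U , big with climb-top v∈U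
  ...   | t , c , top = t , climb-end c , <-≤-trans big (p⊆q⇒∣p∣≤∣q∣ sub)
    where
    sub : component U v ⊆ branch U t
    sub h with reach⇒climb (∈-component⁻ h)
    ... | w , vw , uw with climb-linear vw c
    ...   | inj₁ wt         = ∈-branch⁺ (climb-trans uw wt)
    ...   | inj₂ (here _)   = ∈-branch⁺ uw
    ...   | inj₂ (up _ p d) = contradiction (climb-start d) (top p)

  -- The shedding vertex

  module _ {B U x v} (xv : Climb U x v)
           (v-big : r < ∣ branch U v ∣)
           (v-deepest : ∀ {y} → y ∈ U → r < ∣ branch U y ∣ → depth y ≤ depth v)
           (x-largest : ∀ {y} → Climb U y v → y ∉ B → ∣ branch U y ∣ ≤ ∣ branch U x ∣)
           {A} (B⊆A : B ⊆ A) (max : Maximal (Ind r G) (U - x) A) where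

    private
      A⊆U : A ⊆ U
      A⊆U h = p─q⊆p U ⁅ x ⁆ (proj₁ max h)

      x∉A : x ∉ A
      x∉A h = x∉p-x U (proj₁ max h)

      indA : Ind r G A
      indA = proj₁ (proj₂ max)

      Aˣ : Subset n
      Aˣ = A ∪ ⁅ x ⁆

      A⊆Aˣ : A ⊆ Aˣ
      A⊆Aˣ = p⊆p∪q ⁅ x ⁆

      big-at : ∀ {y} → y ∈ U → y ≢ x → y ∉ A → r < ∣ component (A ∪ ⁅ y ⁆) y ∣
      big-at y∈U y≢x y∉A =
        big-component-at indA (proj₂ (proj₂ max) _ (x∈p∧x≢y⇒x∈p-y y∈U y≢x) y∉A)

      -- By maximality of the branch at x, no vertex strictly between x and v lies outside B.
      x-to-v : Climb Aˣ x v
      x-to-v = climb-restrict xv between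
        where
        between : ∀ {z} → Climb U x z → Climb U z v → z ∈ Aˣ
        between {z} xz zv with x ≟ z | z ∈? B
        ... | yes refl | _       = x∈p∪⁅x⁆ A
        ... | no _     | yes z∈B = A⊆Aˣ (B⊆A z∈B)
        ... | no x≢z   | no z∉B  = contradiction (x-largest zv z∉B) (<⇒≱ (branch-< xz x≢z))

      -- The child `c` of `x` whose branch holds `z` is strictly deeper than `v`, so the choice of
      -- `v` limits that branch to `r` vertices.
      child-above : ∀ {z} → Climb U z x → z ≢ x → ∃ λ c → Climb U z c × Climb U c x × Parent c x
      child-above (here _)            z≢x = contradiction refl z≢x
      child-above (up z∈U p (here h)) _   = _ , here z∈U , up z∈U p (here h) , p
      child-above (up z∈U p d@(up _ (_ , lt) d′)) _
        with child-above d (λ { refl → <⇒≱ lt (climb-depth d′) })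
      ... | c , zc , cx , q = c , up z∈U p zc , cx , q

      -- If `z` were missing, maximality of `A` would make the component of `z` in `A ∪ ⁅ z ⁆`
      -- exceed `r`. But that component cannot pass through `x`, so it lies in the branch of `c`,
      -- which is too deep to be that large.
      below-x⊆A : ∀ {z} → Climb U z x → z ≢ x → z ∈ A
      below-x⊆A {z} zx z≢x with child-above zx z≢x
      ... | c , zc , cx , p = decidable-stable (z ∈? A) λ z∉A →
        <⇒≱ (≤-<-trans (climb-depth xv) (proj₂ p))
            (v-deepest (climb-start cx)
              (<-≤-trans (big-at (climb-start zx) z≢x z∉A) (p⊆q⇒∣p∣≤∣q∣ component⊆branch)))
        where
        Aᶻ⊆U : A ∪ ⁅ z ⁆ ⊆ U
        Aᶻ⊆U = ∪-⁅⁆-⊆ A A⊆U (climb-start zx)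
        x∉Aᶻ : x ∉ A ∪ ⁅ z ⁆
        x∉Aᶻ h with x∈p∪⁅y⁆⁻ A h
        ... | inj₁ k    = x∉A k
        ... | inj₂ refl = z≢x refl
        component⊆branch : component (A ∪ ⁅ z ⁆) z ⊆ branch U c
        component⊆branch h with reach⇒climb (∈-component⁻ h)
        ... | w , zw , uw with climb-linear zw zc
        ...   | inj₁ wc         = ∈-branch⁺ (climb-trans (climb-mono Aᶻ⊆U uw) wc)
        ...   | inj₂ (here _)   = ∈-branch⁺ (climb-mono Aᶻ⊆U uw)
        ...   | inj₂ (up _ q d) with refl ← parent-unique p q = contradiction (climb-start d) x∉Aᶻ

      branch-x-in : ∀ {u} → Climb U u x → Climb Aˣ u x
      branch-x-in ux = climb-restrict ux λ {z} _ zx → case z ≟ x of λ where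
        (yes refl) → x∈p∪⁅x⁆ A
        (no z≢x)   → A⊆Aˣ (below-x⊆A zx z≢x)

      C : Subset n
      C = component Aˣ v

      branch-x⊆C : branch U x ⊆ C
      branch-x⊆C h = ∈-component⁺
        (meet⇒reach (here (climb-end x-to-v)) (climb-trans (branch-x-in (∈-branch⁻ h)) x-to-v))

      -- The climb ends at `v`, which is in `C`, so it must enter `C` along some edge, from `y` to
      -- its parent `p`.
      leaving-C : ∀ {u} → Climb U u v → u ∉ C → ∃ λ y → ∃ λ p → Climb U y v × Parent y p × p ∈ C × y ∉ C
      leaving-C (here _) v∉C = contradiction (∈-component⁺ (here (climb-end x-to-v))) v∉C
      leaving-C c@(up {w} _ p d) u∉C with w ∈? C
      ... | yes w∈C = _ , w , c , p , w∈C , u∉C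
      ... | no w∉C  = leaving-C d w∉C

    shedding-step : ¬ Ind r G (A ∪ ⁅ x ⁆)
    shedding-step indAˣ with any? (λ u → climb? U u v ×-dec ¬? (u ∈? C))
    -- Otherwise `C` would contain the whole branch of `v`, which has more than `r` vertices.
    ... | no ¬u = <⇒≱ (<-≤-trans v-big (p⊆q⇒∣p∣≤∣q∣ λ {u} h →
                    decidable-stable (u ∈? C) λ u∉C → ¬u (u , ∈-branch⁻ h , u∉C)))
                  (component-≤ indAˣ (climb-end x-to-v))
    ... | yes (_ , uv , u∉C) with leaving-C uv u∉C
    ...   | y , p , yv , yp , p∈C , y∉C = <⇒≱ big small
      where
      y∈U : y ∈ U
      y∈U = climb-start yv

      y∉Aˣ : y ∉ Aˣ
      y∉Aˣ h = y∉C (∈-component⁺ (step (∈-component⁻ p∈C) (adj-sym G (proj₁ yp)) h))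

      y∉A : y ∉ A
      y∉A = y∉Aˣ ∘ A⊆Aˣ

      y≢x : y ≢ x
      y≢x refl = y∉Aˣ (x∈p∪⁅x⁆ A)

      big : r < ∣ component (A ∪ ⁅ y ⁆) y ∣
      big = big-at y∈U y≢x y∉A

      Aʸ⊆U : A ∪ ⁅ y ⁆ ⊆ U
      Aʸ⊆U = ∪-⁅⁆-⊆ A A⊆U y∈U

      avoid : ∀ {u w} → Climb (A ∪ ⁅ y ⁆) u w → ¬ Climb U u y → Climb A u w
      avoid c ¬uy = climb-restrict c λ uz zw → [ (λ z∈A → z∈A) ,
        (λ { refl → contradiction (climb-mono Aʸ⊆U uz) ¬uy }) ]′ (x∈p∪⁅y⁆⁻ A (climb-start zw))

      -- A vertex `u` of this component not below `y` is joined to `y` through `p`, and to `p`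
      -- within `A`, so it is in `C`. If it were below `x`, then either its climb to `w` would meet
      -- `x`, which is not in `A`, or `w`, and with it `y`, would be below `x`, forcing `y` into
      -- `A`.
      component⊆ : component (A ∪ ⁅ y ⁆) y ⊆ branch U y ∪ (C ─ branch U x)
      component⊆ {u} h with climb? U u y | reach⇒climb (∈-component⁻ h)
      ... | yes uy | _                 = p⊆p∪q _ (∈-branch⁺ uy)
      ... | no ¬uy | w , here _ , uw   = contradiction (climb-mono Aʸ⊆U uw) ¬uy
      ... | no ¬uy | w , up _ q pw , uw with refl ← parent-unique yp q =
        q⊆p∪q (branch U y) _ (x∈p∧x∉q⇒x∈p─q u∈C (u∉branch ∘ ∈-branch⁻))
        where
        uwA : Climb A u w
        uwA = avoid uw ¬uy
        pwA : Climb A p w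
        pwA = avoid pw λ py → <⇒≱ (proj₂ yp) (climb-depth py)
        u∈C : u ∈ C
        u∈C = ∈-component⁺ (reach-trans (∈-component⁻ p∈C) (reach-mono A⊆Aˣ (meet⇒reach pwA uwA)))
        u∉branch : ¬ Climb U u x
        u∉branch ux with climb-linear ux uwA
        ... | inj₁ xw = x∉A (climb-start xw)
        ... | inj₂ wx =
          y∉A (below-x⊆A (up y∈U yp (climb-trans (climb-mono A⊆U pwA) wx)) y≢x)

      small : ∣ component (A ∪ ⁅ y ⁆) y ∣ ≤ r
      small = begin
        ∣ component (A ∪ ⁅ y ⁆) y ∣             ≤⟨ p⊆q⇒∣p∣≤∣q∣ component⊆ ⟩
        ∣ branch U y ∪ (C ─ branch U x) ∣       ≤⟨ ∣p∪q∣≤∣p∣+∣q∣ (branch U y) _ ⟩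
        -- `y` is outside `A`, hence outside `B`, so it competed in the choice of `x`.
        ∣ branch U y ∣ + ∣ C ─ branch U x ∣     ≤⟨ +-monoˡ-≤ _ (x-largest yv (y∉A ∘ B⊆A)) ⟩
        ∣ branch U x ∣ + ∣ C ─ branch U x ∣     ≡⟨ +-comm ∣ branch U x ∣ _ ⟩
        ∣ C ─ branch U x ∣ + ∣ branch U x ∣     ≡⟨ ∣p─q∣+∣q∣≡∣p∣ C (branch U x) branch-x⊆C ⟩
        ∣ C ∣                                   ≤⟨ component-≤ indAˣ (climb-end x-to-v) ⟩
        r                                       ∎
        where open ℕₚ.≤-Reasoning

  shedding : ∀ {B U} → B ⊆ U → Ind r G B → ¬ Ind r G U → ∃ (Shedding (Ind r G) B U)
  shedding {B} {U} B⊆U indB ¬indU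
    with argmax (λ v → v ∈? U ×-dec r <? ∣ branch U v ∣) depth (big-branch ¬indU)
  ... | v , (v∈U , v-big) , v-deepest
    with any? (λ x → climb? U x v ×-dec ¬? (x ∈? B))
  -- If `B` contained the whole branch of `v`, that branch would be a connected subset of `B` with
  -- more than `r` vertices.
  ...   | no ¬x = contradiction (component-≤ indB (in-B (here v∈U)))
                                (<⇒≱ (<-≤-trans v-big (p⊆q⇒∣p∣≤∣q∣ branch⊆component)))
    where
    in-B : ∀ {x} → Climb U x v → x ∈ B
    in-B {x} xv = decidable-stable (x ∈? B) λ x∉B → ¬x (x , xv , x∉B)
    branch⊆component : branch U v ⊆ component B v
    branch⊆component h = ∈-component⁺
      (reach-sym (climb⇒reach (climb-restrict (∈-branch⁻ h) λ _ zv → in-B zv)))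
  ...   | yes e with argmax (λ x → climb? U x v ×-dec ¬? (x ∈? B)) (λ x → ∣ branch U x ∣) e
  ...     | x , (xv , x∉B) , x-largest = x , climb-start xv , x∉B ,
    shedding-step xv v-big (λ y∈U big → v-deepest _ (y∈U , big))
                  (λ yv y∉B → x-largest _ (yv , y∉B))

theorem4p6 : (n : ℕ) (G : SimpleGraph n) → IsForest G →
    (r : ℕ) → 1 ≤ r → n ∸ 5 ≤ r → Shellable (Ind r G)
theorem4p6 n G forest r _ _ = shellable (Ind r G) ind? ind-mono shedding ind-⊥
  where open Rooted G (forest⇒rooting G forest ⊤) r
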